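{- Let $r\geq 1$ be an integer. There exists $c_r<1$ such that the following holds for every $\alpha$ with $c_r\leq\alpha\leq 1$. Let $n$ be an integer such that $\alpha n$ is an integer. Then every $K_{r+1}$-free graph $G$ on $n$ vertices contains a set $A$ of $\alpha n$ vertices such that \[ e(A)+e(A^c)\leq \frac{r-1}{2r}(2\alpha-1)n^2. \]
   Context: For $A\subseteq V(G)$, $e(A)$ denotes the number of edges of $G$ with both endpoints in $A$, and $A^c=V(G)\setminus A$. $K_{r+1}$ denotes the complete graph on $r+1$ vertices. -}

module Defs where

open import Data.Nat using (ℕ; suc; _+_; _<ᵇ_)
open import Data.Bool using (Bool; true; false; _∧_; if_then_else_)
open import Data.Fin using (Fin; toℕ)
open import Data.Fin.Subset using (Subset)
open import Data.Vec using (lookup)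
open import Data.List using (map; allFin)
open import Data.Nat.ListAction using (sum)
open import Data.Integer using (+_)
open import Data.Rational using (ℚ; _/_)
open import Data.Product using (Σ; _×_)
open import Relation.Binary.PropositionalEquality using (_≡_; _≢_)
open import Relation.Nullary using (¬_)

record Graph (n : ℕ) : Set where
  field
    adj    : Fin n → Fin n → Bool
    sym    : ∀ i j → adj i j ≡ adj j i
    irrefl : ∀ i → adj i i ≡ false
open Graph public

e : ∀ {n} → Graph n → Subset n → ℕ
e {n} G A =
  sum (map (λ i → sum (map (λ j →
      if (toℕ i <ᵇ toℕ j) ∧ lookup A i ∧ lookup A j ∧ adj G i j then 1 else 0)
    (allFin n))) (allFin n))

HasClique : ∀ {n} → ℕ → Graph n → Set
HasClique {n} m G =
  Σ (Fin m → Fin n) λ f → ∀ i j → i ≢ j → (f i ≢ f j) × (adj G (f i) (f j) ≡ true)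

Free : ∀ {n} → ℕ → Graph n → Set
Free m G = ¬ HasClique m G

⟦_⟧ : ℕ → ℚ
⟦ k ⟧ = + k / 1

{-# OPTIONS --safe #-}
module Submission where

-- Let D = 2 e(G) and b = n - k.  Repeatedly splitting off the non-neighbours of a vertex of maximum
-- degree colours G with r colours so that D + P + Q ≤ n², where P counts ordered monochromatic edges
-- and Q ordered monochromatic pairs (Füredi's proof of stability); moreover r Q ≥ n².  Unless D is so
-- small that e(A) + e(Aᶜ) ≤ e(G) suffices, Q is close to n² / r, so every colour class has at least b
-- vertices.  The vertices of some class send on average at least (D - P) / n edges to other classes.
-- Let Aᶜ consist of the b vertices of that class sending the most: at least b (D - P) / n edges cross
-- the cut, and as 4b ≤ n the loss 2bP / n is paid for by the P on the left of D + P + Q ≤ n².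

open import Defs hiding (sym)
open import Data.Nat using (ℕ; _∸_; _≤_)
open import Data.Nat as ℕ using (zero; suc; s≤s; z≤n)
import Data.Nat.Properties as ℕ
import Data.Nat.Tactic.RingSolver as ℕ-Solver
open import Data.Nat.Coprimality using (1-coprimeTo) renaming (sym to coprime-sym)
open import Data.Nat.ListAction using () renaming (sum to sumᴸ)
open import Data.Bool using (Bool; true; false; _∧_; _∨_; not; if_then_else_; T)
open import Data.Bool.Properties using (T-≡)
open import Data.Empty using (⊥-elim)
open import Data.Fin using (Fin; zero; suc; toℕ)
open import Data.Fin.Properties using (toℕ-injective; toℕ<n)
open import Data.Fin.Subset using (Subset; ∁; ∣_∣)
import Data.List as List
import Data.List.Properties as List
open import Data.Product using (Σ; ∃; _×_; _,_; proj₁; proj₂)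
open import Data.Sum using (_⊎_; inj₁; inj₂)
open import Data.Vec using ([]; _∷_; lookup; tabulate)
open import Data.Vec.Properties using (lookup-map; lookup∘tabulate)
open import Function using (_∘_; const; id)
open import Function.Bundles using (Equivalence)
open import Relation.Nullary using (¬_; yes; no; contradiction)
open import Relation.Binary.PropositionalEquality

module Combinatorics where

  open import Data.Nat
  open import Data.Nat.Properties
  open import Data.Nat.Tactic.RingSolver using (solve-∀)
  open import Algebra.Properties.Semiring.Sum +-*-semiring

  -- Finite sums and double sums of natural numbers.

  ι : Bool → ℕ
  ι b = if b then 1 else 0

  ∑-mono : ∀ {n} {f g : Fin n → ℕ} → (∀ i → f i ≤ g i) → sum f ≤ sum g
  ∑-mono {zero}  f≤g = z≤n
  ∑-mono {suc n} f≤g = +-mono-≤ (f≤g zero) (∑-mono (f≤g ∘ suc))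

  ∑-const : ∀ n c → ∑[ i < n ] c ≡ n * c
  ∑-const zero    c = refl
  ∑-const (suc n) c = cong (c +_) (∑-const n c)

  term≤∑ : ∀ {n} (f : Fin n → ℕ) i → f i ≤ sum f
  term≤∑ f zero    = m≤m+n _ _
  term≤∑ f (suc i) = ≤-trans (term≤∑ (f ∘ suc) i) (m≤n+m _ _)

  ∑-pigeonhole : ∀ {n} (f g : Fin (suc n) → ℕ) → sum f ≤ sum g → ∃ λ i → f i ≤ g i
  ∑-pigeonhole {zero}  f g le = zero , subst₂ _≤_ (+-identityʳ _) (+-identityʳ _) le
  ∑-pigeonhole {suc n} f g le with f zero ≤? g zero | sum (f ∘ suc) ≤? sum (g ∘ suc)
  ... | yes p | _     = zero , p
  ... | no _  | yes q = let i , h = ∑-pigeonhole (f ∘ suc) (g ∘ suc) q in suc i , h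
  ... | no p  | no q  = contradiction le (<⇒≱ (+-mono-< (≰⇒> p) (≰⇒> q)))

  -- Colours are naturals with a separate bound, so `f` lives on ℕ; the induction can then shift
  -- both `x` and `f` by one.
  ∑-δ : ∀ r x (f : ℕ → ℕ) → x < r → ∑[ i < r ] (ι (x ≡ᵇ toℕ i) * f (toℕ i)) ≡ f x
  ∑-δ (suc r) zero    f _         =
    trans (cong₂ _+_ (*-identityˡ (f 0)) (trans (∑-const r 0) (*-zeroʳ r))) (+-identityʳ (f 0))
  ∑-δ (suc r) (suc x) f (s≤s x<r) = ∑-δ r x (f ∘ suc) x<r

  ∑-δ₁ : ∀ r x → x < r → ∑[ i < r ] ι (x ≡ᵇ toℕ i) ≡ 1
  ∑-δ₁ r x x<r = trans (sum-cong-≗ {r} λ i → sym (*-identityʳ (ι (x ≡ᵇ toℕ i)))) (∑-δ r x (const 1) x<r)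

  ∑² : ∀ {n} → (Fin n → Fin n → ℕ) → ℕ
  ∑² {n} f = ∑[ u < n ] ∑[ v < n ] f u v

  ∑²-mono : ∀ {n} {f g : Fin n → Fin n → ℕ} → (∀ u v → f u v ≤ g u v) → ∑² f ≤ ∑² g
  ∑²-mono f≤g = ∑-mono λ u → ∑-mono (f≤g u)

  ∑²-cong : ∀ {n} {f g : Fin n → Fin n → ℕ} → (∀ u v → f u v ≡ g u v) → ∑² f ≡ ∑² g
  ∑²-cong f≡g = sum-cong-≗ λ u → sum-cong-≗ (f≡g u)

  ∑²-+ : ∀ {n} (f g : Fin n → Fin n → ℕ) → ∑² (λ u v → f u v + g u v) ≡ ∑² f + ∑² g
  ∑²-+ f g = trans (sum-cong-≗ λ u → ∑-distrib-+ (f u) (g u)) (∑-distrib-+ (sum ∘ f) (sum ∘ g))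

  ∑²-double : ∀ {n} (g : Fin n → Fin n → ℕ) → ∑² (λ u v → g u v + g v u) ≡ 2 * ∑² g
  ∑²-double g = begin
    ∑² (λ u v → g u v + g v u)     ≡⟨ ∑²-+ g (λ u v → g v u) ⟩
    ∑² g + ∑² (λ u v → g v u)      ≡⟨ cong (∑² g +_) (∑-comm (λ u v → g v u)) ⟩
    ∑² g + ∑² g                    ≡⟨ cong (∑² g +_) (sym (+-identityʳ (∑² g))) ⟩
    2 * ∑² g                       ∎
    where open ≡-Reasoning

  -- A pair may be charged to either endpoint, `g u v` to the first and `g v u` to the second;
  -- exchanging the two sums shows that both charges have the same total.
  ∑²-symmetrise : ∀ {n} (f g : Fin n → Fin n → ℕ) →
    ∑² (λ u v → f u v + (g u v + g v u)) ≡ ∑² f + 2 * ∑² g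
  ∑²-symmetrise f g = trans (∑²-+ f (λ u v → g u v + g v u)) (cong (∑² f +_) (∑²-double g))

  ∑²-* : ∀ {n} (f g : Fin n → ℕ) → ∑² (λ u v → f u * g v) ≡ sum f * sum g
  ∑²-* f g = trans (sum-cong-≗ λ u → sym (*-distribˡ-sum (f u) g)) (sym (*-distribʳ-sum (sum g) f))

  -- Maximal elements and sets of heaviest elements.

  argmax : ∀ {n} (p : Fin n → Bool) (w : Fin n → ℕ) →
    (∀ v → p v ≡ false) ⊎ ∃ λ x → p x ≡ true × (∀ v → p v ≡ true → w v ≤ w x)
  argmax {zero}  p w = inj₁ λ ()
  argmax {suc n} p w with p zero in p0 | argmax (p ∘ suc) (w ∘ suc)
  ... | false | inj₁ none = inj₁ λ { zero → p0 ; (suc v) → none v }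
  ... | false | inj₂ (x , px , max) =
    inj₂ (suc x , px , λ { zero pv → contradiction (trans (sym p0) pv) λ () ; (suc v) → max v })
  ... | true  | inj₁ none =
    inj₂ (zero , p0 , λ { zero _ → ≤-refl ; (suc v) pv → contradiction (trans (sym (none v)) pv) λ () })
  ... | true  | inj₂ (x , px , max) with ≤-total (w zero) (w (suc x))
  ...   | inj₁ le = inj₂ (suc x , px , λ { zero _ → le ; (suc v) → max v })
  ...   | inj₂ ge = inj₂ (zero , p0 , λ { zero _ → ≤-refl ; (suc v) pv → ≤-trans (max v pv) ge })

  ≡ᵇ-true : ∀ m n → (m ≡ᵇ n) ≡ true → m ≡ n
  ≡ᵇ-true m n eq = ≡ᵇ⇒≡ m n (Equivalence.from T-≡ eq)

  ≡ᵇ-refl : ∀ m → (m ≡ᵇ m) ≡ true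
  ≡ᵇ-refl m = Equivalence.to T-≡ (≡⇒≡ᵇ m m refl)

  <⇒≢ᵇ : ∀ {m n} → m < n → (m ≡ᵇ n) ≡ false
  <⇒≢ᵇ {m} {n} m<n with m ≡ᵇ n in eq
  ... | false = refl
  ... | true  = contradiction (≡ᵇ-true m n eq) (<⇒≢ m<n)

  ≡ᵇ-comm : ∀ m n → (m ≡ᵇ n) ≡ (n ≡ᵇ m)
  ≡ᵇ-comm zero    zero    = refl
  ≡ᵇ-comm zero    (suc n) = refl
  ≡ᵇ-comm (suc m) zero    = refl
  ≡ᵇ-comm (suc m) (suc n) = ≡ᵇ-comm m n

  card : ∀ {n} → (Fin n → Bool) → ℕ
  card p = sum (ι ∘ p)

  record Top {n} (p : Fin n → Bool) (w : Fin n → ℕ) (b : ℕ) : Set where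
    field
      B     : Fin n → Bool
      B⊆p   : ∀ v → B v ≡ true → p v ≡ true
      ∣B∣   : card B ≡ b
      top   : ∀ u v → B u ≡ true → B v ≡ false → p v ≡ true → w v ≤ w u

  -- Greedy choice: a heaviest element of `p` outside the set chosen so far joins it. One remains
  -- because `p` has more elements than were chosen.
  takeTop : ∀ {n} (p : Fin n → Bool) w b → b ≤ card p → Top p w b
  takeTop {n} p w zero _ = record
    { B = const false ; B⊆p = λ _ () ; ∣B∣ = trans (∑-const n 0) (*-zeroʳ n) ; top = λ _ _ () }
  takeTop {n} p w (suc b) b<p with takeTop p w b (≤-trans (n≤1+n b) b<p)
  ... | record { B = B ; B⊆p = B⊆p ; ∣B∣ = ∣B∣ ; top = top } with argmax (λ v → p v ∧ not (B v)) w
  ...   | inj₁ none = contradiction (≤-trans b<p (≤-trans (∑-mono p⊆B) (≤-reflexive ∣B∣))) 1+n≰n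
    where
    p⊆B : ∀ v → ι (p v) ≤ ι (B v)
    p⊆B v with p v | B v | none v
    ... | false | _    | _ = z≤n
    ... | true  | true | _ = ≤-refl
  ...   | inj₂ (x , qx , max) = record
    { B = B′ ; B⊆p = B′⊆p ; ∣B∣ = ∣B′∣ ; top = top′ }
    where
    B′ : Fin n → Bool
    B′ v = (toℕ x ≡ᵇ toℕ v) ∨ B v
    is-x : ∀ v → (toℕ x ≡ᵇ toℕ v) ≡ true → x ≡ v
    is-x v = toℕ-injective ∘ ≡ᵇ-true (toℕ x) (toℕ v)
    B′⊆p : ∀ v → B′ v ≡ true → p v ≡ true
    B′⊆p v h with toℕ x ≡ᵇ toℕ v in eq
    ... | false = B⊆p v h
    ... | true with is-x v eq
    ...   | refl with p x
    ...     | true = refl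
    disjoint : ∀ v → ι (B′ v) ≡ ι (toℕ x ≡ᵇ toℕ v) + ι (B v)
    disjoint v with toℕ x ≡ᵇ toℕ v in eq
    ... | false = refl
    ... | true with is-x v eq
    ...   | refl with p x | B x
    ...     | true | false = refl
    ∣B′∣ : card B′ ≡ suc b
    ∣B′∣ = trans (sum-cong-≗ disjoint)
      (trans (∑-distrib-+ (λ v → ι (toℕ x ≡ᵇ toℕ v)) (ι ∘ B)) (cong₂ _+_ (∑-δ₁ n (toℕ x) (toℕ<n x)) ∣B∣))
    top′ : ∀ u v → B′ u ≡ true → B′ v ≡ false → p v ≡ true → w v ≤ w u
    top′ u v hu hv pv with toℕ x ≡ᵇ toℕ u in equ | toℕ x ≡ᵇ toℕ v
    ... | false | false = top u v hu hv pv
    ... | true  | false with is-x u equ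
    ...   | refl = max v (subst₂ (λ s t → s ∧ not t ≡ true) (sym pv) (sym hv) refl)

  -- Each chosen element weighs at least as much as each rejected one. Summing over all such pairs
  -- gives `exchange`; adding the contribution of `B` to both sides compares the averages over `B`
  -- and `p`, with denominators cleared.
  top-average : ∀ {n} {p : Fin n → Bool} {w b} (t : Top p w b) →
    b * ∑[ v < n ] (ι (p v) * w v) ≤ card p * ∑[ v < n ] (ι (Top.B t v) * w v)
  top-average {n} {p} {w} {b} t = begin
    b * ∑[ v < n ] (ι (p v) * w v)      ≡⟨ cong₂ _*_ (sym ∣B∣) pw ⟩
    card B * (wB + wq)                  ≡⟨ *-distribˡ-+ (card B) wB wq ⟩
    card B * wB + card B * wq           ≤⟨ +-monoʳ-≤ (card B * wB) exchange ⟩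
    card B * wB + card q * wB           ≡⟨ sym (*-distribʳ-+ wB (card B) (card q)) ⟩
    (card B + card q) * wB              ≡⟨ cong (_* wB) (sym ∣p∣) ⟩
    card p * wB                         ∎
    where
    open ≤-Reasoning
    open Top t
    q : Fin n → Bool
    q v = p v ∧ not (B v)
    wB wq : ℕ
    wB = ∑[ v < n ] (ι (B v) * w v)
    wq = ∑[ v < n ] (ι (q v) * w v)
    split : ∀ v → ι (p v) ≡ ι (B v) + ι (q v)
    split v with B v in Bv | p v in pv
    ... | false | false = refl
    ... | false | true  = refl
    ... | true  | true  = refl
    ... | true  | false = contradiction (trans (sym pv) (B⊆p v Bv)) λ ()
    ∣p∣ : card p ≡ card B + card q
    ∣p∣ = trans (sum-cong-≗ split) (∑-distrib-+ (ι ∘ B) (ι ∘ q))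
    pw : ∑[ v < n ] (ι (p v) * w v) ≡ wB + wq
    pw = trans (sum-cong-≗ {n} λ v → trans (cong (_* w v) (split v)) (*-distribʳ-+ (w v) (ι (B v)) (ι (q v))))
               (∑-distrib-+ (λ v → ι (B v) * w v) (λ v → ι (q v) * w v))
    exchange′ : ∀ u v → ι (B u) * (ι (q v) * w v) ≤ (ι (B u) * w u) * ι (q v)
    exchange′ u v with B u in Bu | p v in pv | B v in Bv
    ... | false | _     | _     = z≤n
    ... | true  | false | _     = z≤n
    ... | true  | true  | true  = z≤n
    ... | true  | true  | false =
      subst₂ _≤_ (sym (trans (*-identityˡ _) (*-identityˡ _))) (sym (trans (*-identityʳ _) (*-identityˡ _)))
        (top u v Bu Bv pv)
    exchange : card B * wq ≤ card q * wB
    exchange = begin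
      card B * wq                                       ≡⟨ sym (∑²-* (ι ∘ B) (λ v → ι (q v) * w v)) ⟩
      ∑² (λ u v → ι (B u) * (ι (q v) * w v))            ≤⟨ ∑²-mono exchange′ ⟩
      ∑² (λ u v → (ι (B u) * w u) * ι (q v))            ≡⟨ ∑²-* (λ u → ι (B u) * w u) (ι ∘ q) ⟩
      wB * card q                                       ≡⟨ *-comm wB (card q) ⟩
      card q * wB                                       ∎

  -- Füredi's colouring of graphs without large cliques.

  CliqueIn : ∀ {n} → Graph n → (Fin n → Bool) → ℕ → Set
  CliqueIn {n} G S m = Σ (Fin m → Fin n) λ f →
    (∀ i → S (f i) ≡ true) × (∀ i j → i ≢ j → adj G (f i) (f j) ≡ true)

  module _ {n} (G : Graph n) where

    a : Fin n → Fin n → ℕ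
    a u v = ι (adj G u v)

    a-sym : ∀ u v → a u v ≡ a v u
    a-sym u v = cong ι (Graph.sym G u v)

    -- Both sums range over ordered pairs in S; weighted counts monochromatic edges twice.
    weighted : (Fin n → Bool) → (Fin n → ℕ) → ℕ
    weighted S c = ∑² λ u v → ι (S u) * ι (S v) * a u v * (1 + ι (c u ≡ᵇ c v))

    bichromatic : (Fin n → Bool) → (Fin n → ℕ) → ℕ
    bichromatic S c = ∑² λ u v → ι (S u) * ι (S v) * ι (not (c u ≡ᵇ c v))

    empty-weighted : ∀ S c → (∀ v → S v ≡ false) → weighted S c ≤ bichromatic S c
    empty-weighted S c none = ∑²-mono λ u v → subst
      (λ s → ι s * ι (S v) * a u v * (1 + ι (c u ≡ᵇ c v)) ≤ ι s * ι (S v) * ι (not (c u ≡ᵇ c v)))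
      (sym (none u)) z≤n

    extend-clique : ∀ {S m} x → S x ≡ true → CliqueIn G (λ v → S v ∧ adj G x v) m → CliqueIn G S (suc m)
    extend-clique {S} {m} x Sx (f , inS , clique) = f′ , inS′ , clique′
      where
      ∧-left : ∀ s t → s ∧ t ≡ true → s ≡ true
      ∧-left true _ _ = refl
      ∧-right : ∀ s t → s ∧ t ≡ true → t ≡ true
      ∧-right true _ h = h
      x~ : ∀ j → adj G x (f j) ≡ true
      x~ j = ∧-right (S (f j)) (adj G x (f j)) (inS j)
      f′ : Fin (suc m) → Fin n
      f′ zero    = x
      f′ (suc i) = f i
      inS′ : ∀ i → S (f′ i) ≡ true
      inS′ zero    = Sx
      inS′ (suc i) = ∧-left _ _ (inS i)
      clique′ : ∀ i j → i ≢ j → adj G (f′ i) (f′ j) ≡ true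
      clique′ zero    zero    i≢j = contradiction refl i≢j
      clique′ zero    (suc j) _   = x~ j
      clique′ (suc i) zero    _   = trans (Graph.sym G (f i) x) (x~ i)
      clique′ (suc i) (suc j) i≢j = clique i j (i≢j ∘ cong suc)

    -- `su` and `nu` say whether `u` lies in `S` and is adjacent to the pivot; non-neighbours
    -- receive the fresh colour `r`. A mixed edge is bichromatic, weighs 1 and is charged to its
    -- non-neighbour; an edge between two non-neighbours weighs 2 and is charged to both ends.
    weighted-step : ∀ su sv nu nv a cu cv r →
      (su ∧ nu ≡ true → cu < r) → (sv ∧ nv ≡ true → cv < r) →
      ι su * ι sv * a * (1 + ι ((if nu then cu else r) ≡ᵇ (if nv then cv else r))) ≤
      ι (su ∧ nu) * ι (sv ∧ nv) * a * (1 + ι (cu ≡ᵇ cv)) +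
        (ι (su ∧ not nu) * (ι sv * a) + ι (sv ∧ not nv) * (ι su * a))
    weighted-step false _     _     _     a cu cv r _  _  = z≤n
    weighted-step true  false _     _     a cu cv r _  _  = z≤n
    weighted-step true  true  true  true  a cu cv r _  _  = m≤m+n _ _
    weighted-step true  true  true  false a cu cv r hu _
      rewrite <⇒≢ᵇ (hu refl) = ≤-reflexive (lem a)
      where
      lem : ∀ a → 1 * 1 * a * 1 ≡ 1 * 0 * a * (1 + ι (cu ≡ᵇ cv)) + (0 * (1 * a) + 1 * (1 * a))
      lem = solve-∀
    weighted-step true  true  false true  a cu cv r _  hv
      rewrite ≡ᵇ-comm r cv | <⇒≢ᵇ (hv refl) = ≤-reflexive (lem a)
      where
      lem : ∀ a → 1 * 1 * a * 1 ≡ 0 * 1 * a * (1 + ι (cu ≡ᵇ cv)) + (1 * (1 * a) + 0 * (1 * a))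
      lem = solve-∀
    weighted-step true  true  false false a cu cv r _  _
      rewrite ≡ᵇ-refl r = ≤-reflexive (lem a)
      where
      lem : ∀ a → 1 * 1 * a * 2 ≡ 0 * 0 * a * (1 + ι (cu ≡ᵇ cv)) + (1 * (1 * a) + 1 * (1 * a))
      lem = solve-∀

    -- The fresh colour differs from all old ones, so a non-neighbour and a neighbour always form a
    -- bichromatic pair; two non-neighbours share a colour and contribute nothing.
    bichromatic-step : ∀ su sv nu nv cu cv r →
      (su ∧ nu ≡ true → cu < r) → (sv ∧ nv ≡ true → cv < r) →
      ι (su ∧ nu) * ι (sv ∧ nv) * ι (not (cu ≡ᵇ cv)) +
        (ι (su ∧ not nu) * ι (sv ∧ nv) + ι (sv ∧ not nv) * ι (su ∧ nu)) ≤
      ι su * ι sv * ι (not ((if nu then cu else r) ≡ᵇ (if nv then cv else r)))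
    bichromatic-step false sv    _     nv    cu cv r _  _  rewrite *-zeroʳ (ι (sv ∧ not nv)) = z≤n
    bichromatic-step true  false nu    _     cu cv r _  _
      rewrite *-zeroʳ (ι nu) | *-zeroʳ (ι (not nu)) = z≤n
    bichromatic-step true  true  true  true  cu cv r _  _  = ≤-reflexive (+-identityʳ _)
    bichromatic-step true  true  true  false cu cv r hu _  rewrite <⇒≢ᵇ (hu refl) = ≤-refl
    bichromatic-step true  true  false true  cu cv r _  hv
      rewrite ≡ᵇ-comm r cv | <⇒≢ᵇ (hv refl) = ≤-refl
    bichromatic-step true  true  false false cu cv r _  _  rewrite ≡ᵇ-refl r = z≤n

    -- In unordered terms the inequality says that the edges in `S` plus the monochromatic ones
    -- among them are at most the edges of the complete multipartite graph on the colour classes.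
    Coloured : ℕ → (Fin n → Bool) → Set
    Coloured r S = ∃ λ (c : Fin n → ℕ) →
      (∀ v → S v ≡ true → c v < r) × weighted S c ≤ bichromatic S c

    -- The neighbours in `S` of a vertex `x` of maximum degree contain only smaller cliques and are
    -- coloured by induction; the non-neighbours, `x` among them, get the fresh colour. Their degree
    -- sum, which counts an edge between two of them twice, is at most `|V₁| |S′|`, the number of
    -- new bichromatic pairs.
    füredi : ∀ r S → ¬ CliqueIn G S (suc r) → Coloured r S
    -- Without colours even a single vertex would be a forbidden clique, so `S` is empty.
    füredi zero S free = const 0 , (λ v Sv → ⊥-elim (free (single v Sv))) , empty-weighted S (const 0) none
      where
      single : ∀ v → S v ≡ true → CliqueIn G S 1
      single v Sv = const v , const Sv , λ { zero zero i≢j → contradiction refl i≢j }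
      none : ∀ v → S v ≡ false
      none v with S v in Sv
      ... | false = refl
      ... | true  = ⊥-elim (free (single v Sv))
    füredi (suc r) S free with argmax S (λ u → ∑[ v < n ] (ι (S v) * a u v))
    ... | inj₁ none = const 0 , (λ _ _ → s≤s z≤n) , empty-weighted S (const 0) none
    ... | inj₂ (x , Sx , max) with füredi r (λ v → S v ∧ adj G x v) (free ∘ extend-clique x Sx)
    ...   | c , c<r , ih = c′ , c′<r , bound
      where
      N S′ V₁ : Fin n → Bool
      N  = adj G x
      S′ v = S v ∧ N v
      V₁ v = S v ∧ not (N v)
      c′ : Fin n → ℕ
      c′ v = if N v then c v else r
      c′<r : ∀ v → S v ≡ true → c′ v < suc r
      c′<r v Sv with N v in Nv
      ... | false = ≤-refl
      ... | true  = m≤n⇒m≤1+n (c<r v (subst₂ (λ s t → s ∧ t ≡ true) (sym Sv) (sym Nv) refl))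
      degree : ∀ x v → ι (S v) * a x v ≡ ι (S v ∧ adj G x v)
      degree x v with S v
      ... | true  = *-identityˡ _
      ... | false = refl
      -- x has maximum degree in S, and its neighbours in S are exactly S′.
      few-edges : ∀ u → ι (V₁ u) * ∑[ v < n ] (ι (S v) * a u v) ≤ ι (V₁ u) * card S′
      few-edges u with S u in Su | N u
      ... | false | _     = z≤n
      ... | true  | true  = z≤n
      ... | true  | false = *-monoʳ-≤ 1 (≤-trans (max u Su) (≤-reflexive (sum-cong-≗ (degree x))))
      -- `X` marks the ordered edges of `S` that start in `V₁`, `Y` the ordered pairs from `V₁` to
      -- `S′`.
      X Y : Fin n → Fin n → ℕ
      X u v = ι (V₁ u) * (ι (S v) * a u v)
      Y u v = ι (V₁ u) * ι (S′ v)
      ∑X≤∑Y : ∑² X ≤ ∑² Y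
      ∑X≤∑Y = ∑-mono λ u → subst₂ _≤_ (*-distribˡ-sum (ι (V₁ u)) (λ v → ι (S v) * a u v)) (*-distribˡ-sum (ι (V₁ u)) (ι ∘ S′)) (few-edges u)
      w b : Fin n → Fin n → ℕ
      w u v = ι (S′ u) * ι (S′ v) * a u v * (1 + ι (c u ≡ᵇ c v))
      b u v = ι (S′ u) * ι (S′ v) * ι (not (c u ≡ᵇ c v))
      w-step : ∀ u v → ι (S u) * ι (S v) * a u v * (1 + ι (c′ u ≡ᵇ c′ v)) ≤ w u v + (X u v + X v u)
      w-step u v = begin
        ι (S u) * ι (S v) * a u v * (1 + ι (c′ u ≡ᵇ c′ v))
          ≤⟨ weighted-step (S u) (S v) (N u) (N v) (a u v) (c u) (c v) r (c<r u) (c<r v) ⟩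
        w u v + (X u v + ι (V₁ v) * (ι (S u) * a u v))
          ≡⟨ cong (λ z → w u v + (X u v + ι (V₁ v) * (ι (S u) * z))) (a-sym u v) ⟩
        w u v + (X u v + X v u) ∎
        where open ≤-Reasoning
      open ≤-Reasoning
      bound : weighted S c′ ≤ bichromatic S c′
      bound = begin
        weighted S c′                          ≤⟨ ∑²-mono w-step ⟩
        ∑² (λ u v → w u v + (X u v + X v u))   ≡⟨ ∑²-symmetrise w X ⟩
        weighted S′ c + 2 * ∑² X               ≤⟨ +-mono-≤ ih (*-monoʳ-≤ 2 ∑X≤∑Y) ⟩
        bichromatic S′ c + 2 * ∑² Y            ≡⟨ sym (∑²-symmetrise b Y) ⟩
        ∑² (λ u v → b u v + (Y u v + Y v u))
          ≤⟨ ∑²-mono (λ u v → bichromatic-step (S u) (S v) (N u) (N v) (c u) (c v) r (c<r u) (c<r v)) ⟩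
        bichromatic S c′                       ∎

  -- Sizes of the colour classes and their variance.

  [x+d]² : ∀ x d → 2 * (x * (x + d)) + d * d ≡ x * x + (x + d) * (x + d)
  [x+d]² = solve-∀

  ∣-∣² : ∀ x y → 2 * (x * y) + ∣ x - y ∣ * ∣ x - y ∣ ≡ x * x + y * y
  ∣-∣² x y with ≤-total x y
  ... | inj₁ x≤y = subst (λ z → 2 * (x * z) + ∣ x - z ∣ * ∣ x - z ∣ ≡ x * x + z * z) (m+[n∸m]≡n x≤y)
    (subst (λ d → 2 * (x * (x + (y ∸ x))) + d * d ≡ x * x + (x + (y ∸ x)) * (x + (y ∸ x)))
      (sym (trans (m≤n⇒∣m-n∣≡n∸m (m≤m+n x (y ∸ x))) (m+n∸m≡n x (y ∸ x)))) ([x+d]² x (y ∸ x)))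
  ... | inj₂ y≤x = subst (λ z → 2 * (z * y) + ∣ z - y ∣ * ∣ z - y ∣ ≡ z * z + y * y) (m+[n∸m]≡n y≤x)
    (subst (λ d → 2 * ((y + (x ∸ y)) * y) + d * d ≡ (y + (x ∸ y)) * (y + (x ∸ y)) + y * y)
      (sym (trans (∣-∣-comm (y + (x ∸ y)) y) (trans (m≤n⇒∣m-n∣≡n∸m (m≤m+n y (x ∸ y))) (m+n∸m≡n y (x ∸ y)))))
      (flipped y (x ∸ y)))
    where
    flipped : ∀ x d → 2 * ((x + d) * x) + d * d ≡ (x + d) * (x + d) + x * x
    flipped = solve-∀

  colourClass : ∀ {n} → (Fin n → ℕ) → ℕ → Fin n → Bool
  colourClass c j v = c v ≡ᵇ j

  size : ∀ {n r} → (Fin n → ℕ) → Fin r → ℕ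
  size c i = card (colourClass c (toℕ i))

  -- Distance of the class size from the mean `n / r`, multiplied by `r` to stay integral.
  deviation : ∀ {n r} → (Fin n → ℕ) → Fin r → ℕ
  deviation {n} {r} c i = ∣ n - r * size c i ∣

  -- The pairs are ordered and include the diagonal, so the total is the sum of the squared class
  -- sizes.
  mono-pairs : ∀ {n} → (Fin n → ℕ) → ℕ
  mono-pairs c = ∑² λ u v → ι (c u ≡ᵇ c v)

  module _ {n r} (c : Fin n → ℕ) (c<r : ∀ v → c v < r) where

    -- Every vertex has exactly one colour, so after the sums are exchanged the inner one has a
    -- single surviving term. Letting `f` depend on the colour allows class sizes as weights.
    ∑-by-colour : ∀ (f : Fin n → ℕ → ℕ) →
      ∑[ i < r ] ∑[ v < n ] (ι (c v ≡ᵇ toℕ i) * f v (toℕ i)) ≡ ∑[ v < n ] f v (c v)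
    ∑-by-colour f = trans (∑-comm {r} {n} (λ i v → ι (c v ≡ᵇ toℕ i) * f v (toℕ i)))
      (sum-cong-≗ λ v → ∑-δ r (c v) (f v) (c<r v))

    ∑-size : ∑[ i < r ] size c i ≡ n
    ∑-size = begin
      ∑[ i < r ] size c i
        ≡⟨ sum-cong-≗ {r} (λ i → sum-cong-≗ {n} λ v → sym (*-identityʳ (ι (c v ≡ᵇ toℕ i)))) ⟩
      ∑[ i < r ] ∑[ v < n ] (ι (c v ≡ᵇ toℕ i) * 1)
        ≡⟨ ∑-by-colour (λ _ _ → 1) ⟩
      ∑[ v < n ] 1
        ≡⟨ trans (∑-const n 1) (*-identityʳ n) ⟩
      n ∎
      where open ≡-Reasoning

    ∑-size² : ∑[ i < r ] (size c i * size c i) ≡ mono-pairs c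
    ∑-size² = begin
      ∑[ i < r ] (size c i * size c i)
        ≡⟨ sum-cong-≗ {r} (λ i → *-distribʳ-sum {n} (size c i) (ι ∘ colourClass c (toℕ i))) ⟩
      ∑[ i < r ] ∑[ v < n ] (ι (c v ≡ᵇ toℕ i) * card (colourClass c (toℕ i)))
        ≡⟨ ∑-by-colour (λ _ j → card (colourClass c j)) ⟩
      ∑[ v < n ] ∑[ u < n ] ι (c u ≡ᵇ c v)
        ≡⟨ ∑-comm {n} {n} (λ v u → ι (c u ≡ᵇ c v)) ⟩
      mono-pairs c ∎
      where open ≡-Reasoning

    -- Variance identity for the class sizes, whose mean is `n / r`. It serves twice: non-negative
    -- squares give `n² ≤ r Q`, and few monochromatic pairs keep every class near the mean.
    ∑-deviation² : r * (n * n) + ∑[ i < r ] (deviation c i * deviation c i) ≡ r * r * mono-pairs c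
    -- Adding `r n²` to both sides completes the cross term: `2 n r` times the sum of the sizes is
    -- `2 r n²`.
    ∑-deviation² = +-cancelˡ-≡ (r * (n * n)) _ _ (begin
      r * (n * n) + (r * (n * n) + V)
        ≡⟨ twice r n V ⟩
      2 * n * r * n + V
        ≡⟨ cong (λ z → 2 * n * r * z + V) (sym ∑-size) ⟩
      2 * n * r * (∑[ i < r ] size c i) + V
        ≡⟨ cong (_+ V) (*-distribˡ-sum {r} (2 * n * r) (size c)) ⟩
      ∑[ i < r ] (2 * n * r * size c i) + V
        ≡⟨ sym (∑-distrib-+ {r} (λ i → 2 * n * r * size c i) (λ i → deviation c i * deviation c i)) ⟩
      ∑[ i < r ] (2 * n * r * size c i + deviation c i * deviation c i)
        ≡⟨ sum-cong-≗ {r} expand ⟩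
      ∑[ i < r ] (n * n + r * r * (size c i * size c i))
        ≡⟨ ∑-distrib-+ {r} (λ _ → n * n) (λ i → r * r * (size c i * size c i)) ⟩
      ∑[ i < r ] (n * n) + ∑[ i < r ] (r * r * (size c i * size c i))
        ≡⟨ cong₂ _+_ (∑-const r (n * n)) (sym (*-distribˡ-sum {r} (r * r) (λ i → size c i * size c i))) ⟩
      r * (n * n) + r * r * ∑[ i < r ] (size c i * size c i)
        ≡⟨ cong (λ z → r * (n * n) + r * r * z) ∑-size² ⟩
      r * (n * n) + r * r * mono-pairs c ∎)
      where
      open ≡-Reasoning
      V : ℕ
      V = ∑[ i < r ] (deviation c i * deviation c i)
      twice : ∀ r n V → r * (n * n) + (r * (n * n) + V) ≡ 2 * n * r * n + V
      twice = solve-∀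
      reassoc : ∀ n r s → 2 * n * r * s ≡ 2 * (n * (r * s))
      reassoc = solve-∀
      square : ∀ n r s → n * n + (r * s) * (r * s) ≡ n * n + r * r * (s * s)
      square = solve-∀
      expand : ∀ i → 2 * n * r * size c i + deviation c i * deviation c i ≡ n * n + r * r * (size c i * size c i)
      expand i = trans (cong (_+ deviation c i * deviation c i) (reassoc n r (size c i)))
        (trans (∣-∣² n (r * size c i)) (square n r (size c i)))

  -- Numerical inequalities between the counts.

  -- In few-mono-pairs and cut-arithmetic D, P, Q, O count ordered pairs: edges, monochromatic edges, monochromatic
  -- pairs and bichromatic edges; X counts ordered uncut edges and C the edges across the cut.
  few-mono-pairs : ∀ r′ n b D P Q → let r = suc r′ in
    D + P + Q ≤ n * n → r′ * (n * n) ≤ r * D + r′ * (n * (2 * b)) →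
    r * r * Q ≤ r * (n * n) + n * (2 * (r * r) * b)
  few-mono-pairs r′ n b D P Q F dense = +-cancelˡ-≤ (r * r′ * (n * n)) _ _ (begin
    r * r′ * (n * n) + r * r * Q                         ≡⟨ e₁ r r′ (n * n) Q ⟩
    r * (r′ * (n * n) + r * Q)                           ≤⟨ *-monoʳ-≤ r (+-monoˡ-≤ (r * Q) dense) ⟩
    r * (r * D + r′ * (n * (2 * b)) + r * Q)             ≤⟨ *-monoʳ-≤ r (+-monoˡ-≤ (r * Q) (+-monoʳ-≤ (r * D)
                                                              (*-monoˡ-≤ (n * (2 * b)) (n≤1+n r′)))) ⟩
    r * (r * D + r * (n * (2 * b)) + r * Q)              ≤⟨ m≤m+n _ (r * r * P) ⟩
    r * (r * D + r * (n * (2 * b)) + r * Q) + r * r * P  ≡⟨ e₂ r D P Q n b ⟩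
    r * r * (D + P + Q) + n * (2 * (r * r) * b)          ≤⟨ +-monoˡ-≤ _ (*-monoʳ-≤ (r * r) F) ⟩
    r * r * (n * n) + n * (2 * (r * r) * b)              ≡⟨ e₃ r′ n b ⟩
    r * r′ * (n * n) + (r * (n * n) + n * (2 * (r * r) * b)) ∎)
    where
    open ≤-Reasoning
    r = suc r′
    e₁ : ∀ r r′ N Q → r * r′ * N + r * r * Q ≡ r * (r′ * N + r * Q)
    e₁ = solve-∀
    e₂ : ∀ r D P Q n b → r * (r * D + r * (n * (2 * b)) + r * Q) + r * r * P ≡
                         r * r * (D + P + Q) + n * (2 * (r * r) * b)
    e₂ = solve-∀
    e₃ : ∀ r′ n b → (1 + r′) * (1 + r′) * (n * n) + n * (2 * ((1 + r′) * (1 + r′)) * b) ≡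
      (1 + r′) * r′ * (n * n) + ((1 + r′) * (n * n) + n * (2 * ((1 + r′) * (1 + r′)) * b))
    e₃ = solve-∀

  -- A class with m < b vertices has n - r m ≥ 3n/4, while the sum of all squared deviations is at most n²/2.
  big-parts : ∀ {n r} (c : Fin n → ℕ) (c<r : ∀ v → c v < r) b → 4 * (r * r) * b ≤ n →
    r * r * mono-pairs c ≤ r * (n * n) + n * (2 * (r * r) * b) → ∀ j → b ≤ size c j
  big-parts {n} {r} c c<r b b-small few j = ≮⇒≥ λ m<b → contradiction (nine≤eight m<b) (<⇒≱ (8<9 m<b))
    where
    open ≤-Reasoning
    m d V : ℕ
    m = size c j
    d = deviation c j
    V = ∑[ i < r ] (deviation c i * deviation c i)
    1≤r : 1 ≤ r
    1≤r = ≤-trans (s≤s z≤n) (toℕ<n j)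
    instance
      r≢0 : NonZero r
      r≢0 = >-nonZero 1≤r
    -- The variance identity turns the bound on monochromatic pairs into one on the total squared
    -- deviation.
    V≤ : V ≤ n * (2 * (r * r) * b)
    V≤ = +-cancelˡ-≤ (r * (n * n)) _ _ (≤-trans (≤-reflexive (∑-deviation² c c<r)) few)
    2d²≤n² : 2 * (d * d) ≤ n * n
    2d²≤n² = begin
      2 * (d * d)                   ≤⟨ *-monoʳ-≤ 2 (term≤∑ (λ i → deviation c i * deviation c i) j) ⟩
      2 * V                         ≤⟨ *-monoʳ-≤ 2 V≤ ⟩
      2 * (n * (2 * (r * r) * b))   ≡⟨ e₁ n r b ⟩
      n * (4 * (r * r) * b)         ≤⟨ *-monoʳ-≤ n b-small ⟩
      n * n                         ∎
      where
      e₁ : ∀ n r b → 2 * (n * (2 * (r * r) * b)) ≡ n * (4 * (r * r) * b)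
      e₁ = solve-∀
    module _ (m<b : m < b) where
      n>0 : 0 < n
      n>0 = begin-strict
        0                  ≤⟨ z≤n ⟩
        m                  <⟨ m<b ⟩
        b                  ≤⟨ m≤n*m b (r * r) {{m*n≢0 r r}} ⟩
        r * r * b          ≤⟨ m≤n*m _ 4 ⟩
        4 * (r * r * b)    ≡⟨ sym (*-assoc 4 (r * r) b) ⟩
        4 * (r * r) * b    ≤⟨ b-small ⟩
        n                  ∎
      4rm≤n : 4 * (r * m) ≤ n
      4rm≤n = begin
        4 * (r * m)        ≤⟨ *-monoʳ-≤ 4 (*-mono-≤ (m≤m*n r r) (<⇒≤ m<b)) ⟩
        4 * (r * r * b)    ≡⟨ sym (*-assoc 4 (r * r) b) ⟩
        4 * (r * r) * b    ≤⟨ b-small ⟩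
        n                  ∎
      3n≤4d : 3 * n ≤ 4 * d
      3n≤4d = +-cancelˡ-≤ n _ _ (begin
        4 * n                    ≤⟨ *-monoʳ-≤ 4 (m≤n+∣m-n∣ n (r * m)) ⟩
        4 * (r * m + d)          ≡⟨ *-distribˡ-+ 4 (r * m) d ⟩
        4 * (r * m) + 4 * d      ≤⟨ +-monoˡ-≤ (4 * d) 4rm≤n ⟩
        n + 4 * d                ∎)
      nine≤eight : 9 * (n * n) ≤ 8 * (n * n)
      nine≤eight = begin
        9 * (n * n)              ≡⟨ e₁ n ⟩
        (3 * n) * (3 * n)        ≤⟨ *-mono-≤ 3n≤4d 3n≤4d ⟩
        (4 * d) * (4 * d)        ≡⟨ e₂ d ⟩
        8 * (2 * (d * d))        ≤⟨ *-monoʳ-≤ 8 2d²≤n² ⟩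
        8 * (n * n)              ∎
        where
        e₁ : ∀ n → 9 * (n * n) ≡ (3 * n) * (3 * n)
        e₁ = solve-∀
        e₂ : ∀ d → (4 * d) * (4 * d) ≡ 8 * (2 * (d * d))
        e₂ = solve-∀
      8<9 : 8 * (n * n) < 9 * (n * n)
      8<9 = m<n+m _ (*-mono-< n>0 n>0)

  cut-arithmetic : ∀ r′ n b X C D O P Q → .{{_ : NonZero n}} → let r = suc r′ in
    4 * b ≤ n → D ≡ X + 2 * C → D ≡ O + P → b * O ≤ n * C → D + P + Q ≤ n * n → n * n ≤ r * Q →
    r * X + r′ * (n * (2 * b)) ≤ r′ * (n * n)
  cut-arithmetic r′ n b X C D O P Q 4b≤n D≡X+2C D≡O+P bO≤nC F Q-large = *-cancelˡ-≤ n (begin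
    n * (r * X + r′ * (n * (2 * b)))             ≡⟨ e₁ n r X r′ b ⟩
    r * (n * X) + 2 * b * (r′ * (n * n))         ≤⟨ +-monoˡ-≤ _ (*-monoʳ-≤ r nX≤) ⟩
    r * ((2 * b + s) * (D + P)) + 2 * b * (r′ * (n * n))
                                                 ≡⟨ cong (_+ 2 * b * (r′ * (n * n))) (e₂ r (2 * b + s) (D + P)) ⟩
    (2 * b + s) * (r * (D + P)) + 2 * b * (r′ * (n * n))
                                                 ≤⟨ +-monoˡ-≤ _ (*-monoʳ-≤ (2 * b + s) turán) ⟩
    (2 * b + s) * (r′ * (n * n)) + 2 * b * (r′ * (n * n))
                                                 ≡⟨ e₃ b s (r′ * (n * n)) ⟩
    (4 * b + s) * (r′ * (n * n))                 ≡⟨ cong (_* (r′ * (n * n))) 4b+s≡n ⟩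
    n * (r′ * (n * n))                           ∎)
    where
    open ≤-Reasoning
    r = suc r′
    -- Writing `n` as `4b + s` makes `n - 2b` equal to `2b + s`, which avoids subtraction and shows
    -- that it is at least `2b`.
    s = n ∸ 4 * b
    4b+s≡n : 4 * b + s ≡ n
    4b+s≡n = m+[n∸m]≡n 4b≤n
    e₁ : ∀ n r X r′ b → n * (r * X + r′ * (n * (2 * b))) ≡ r * (n * X) + 2 * b * (r′ * (n * n))
    e₁ = solve-∀
    e₂ : ∀ r z D → r * (z * D) ≡ z * (r * D)
    e₂ = solve-∀
    e₃ : ∀ b s N → (2 * b + s) * N + 2 * b * N ≡ (4 * b + s) * N
    e₃ = solve-∀
    -- Turán's bound, strengthened by `P`: `Q` takes at least `n² / r` out of `D + P + Q ≤ n²`.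
    turán : r * (D + P) ≤ r′ * (n * n)
    turán = +-cancelˡ-≤ (n * n) _ _ (begin
      n * n + r * (D + P)         ≤⟨ +-monoˡ-≤ _ Q-large ⟩
      r * Q + r * (D + P)         ≡⟨ e₄ r Q (D + P) ⟩
      r * (D + P + Q)             ≤⟨ *-monoʳ-≤ r F ⟩
      r * (n * n)                 ∎)
      where
      e₄ : ∀ r Q E → r * Q + r * E ≡ r * (E + Q)
      e₄ = solve-∀
    -- The cut removes at least `2b O / n` ordered edges and `O = D - P`, so
    -- `n X ≤ (n - 2b) D + 2b P`. As `2b ≤ n - 2b`, the loss `2b P` fits into `(n - 2b) P` with
    -- `s P` to spare.
    nX≤ : n * X ≤ (2 * b + s) * (D + P)
    nX≤ = +-cancelʳ-≤ (2 * b * O) _ _ (begin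
      n * X + 2 * b * O           ≡⟨ cong (n * X +_) (*-assoc 2 b O) ⟩
      n * X + 2 * (b * O)         ≤⟨ +-monoʳ-≤ (n * X) (*-monoʳ-≤ 2 bO≤nC) ⟩
      n * X + 2 * (n * C)         ≡⟨ e₅ n X C ⟩
      n * (X + 2 * C)             ≡⟨ cong (n *_) (sym D≡X+2C) ⟩
      n * D                       ≡⟨ cong₂ _*_ (sym 4b+s≡n) refl ⟩
      (4 * b + s) * D             ≡⟨ e₆ b s D ⟩
      (2 * b + s) * D + 2 * b * D ≡⟨ cong (λ z → (2 * b + s) * D + 2 * b * z) D≡O+P ⟩
      (2 * b + s) * D + 2 * b * (O + P)
                                  ≤⟨ m≤m+n _ (s * P) ⟩
      (2 * b + s) * D + 2 * b * (O + P) + s * P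
                                  ≡⟨ e₇ b s D O P ⟩
      (2 * b + s) * (D + P) + 2 * b * O ∎)
      where
      e₅ : ∀ n X C → n * X + 2 * (n * C) ≡ n * (X + 2 * C)
      e₅ = solve-∀
      e₆ : ∀ b s D → (4 * b + s) * D ≡ (2 * b + s) * D + 2 * b * D
      e₆ = solve-∀
      e₇ : ∀ b s D O P → (2 * b + s) * D + 2 * b * (O + P) + s * P ≡ (2 * b + s) * (D + P) + 2 * b * O
      e₇ = solve-∀

  -- Edges within and across a cut, and edges between colour classes.

  module _ {n} (G : Graph n) where

    inside crossing : (Fin n → Bool) → ℕ
    inside B = ∑² λ u v → (ι (B u) * ι (B v) + ι (not (B u)) * ι (not (B v))) * a G u v
    crossing B = ∑² λ u v → ι (B u) * ι (not (B v)) * a G u v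

    edges-split : ∀ B → ∑² (a G) ≡ inside B + 2 * crossing B
    edges-split B = trans (∑²-cong split) (∑²-symmetrise f g)
      where
      f g : Fin n → Fin n → ℕ
      f u v = (ι (B u) * ι (B v) + ι (not (B u)) * ι (not (B v))) * a G u v
      g u v = ι (B u) * ι (not (B v)) * a G u v
      split : ∀ u v → a G u v ≡ f u v + (g u v + g v u)
      split u v rewrite a-sym G v u with B u | B v
      ... | false | false = e₁ (a G u v)
        where
        e₁ : ∀ x → x ≡ (0 * 0 + 1 * 1) * x + (0 * 1 * x + 0 * 1 * x)
        e₁ = solve-∀
      ... | false | true  = e₁ (a G u v)
        where
        e₁ : ∀ x → x ≡ (0 * 1 + 1 * 0) * x + (0 * 0 * x + 1 * 1 * x)
        e₁ = solve-∀
      ... | true  | false = e₁ (a G u v)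
        where
        e₁ : ∀ x → x ≡ (1 * 0 + 0 * 1) * x + (1 * 1 * x + 0 * 0 * x)
        e₁ = solve-∀
      ... | true  | true  = e₁ (a G u v)
        where
        e₁ : ∀ x → x ≡ (1 * 1 + 0 * 0) * x + (1 * 0 * x + 1 * 0 * x)
        e₁ = solve-∀

    -- Adjacent vertices are distinct by irreflexivity, which is why `CliqueIn` can omit
    -- injectivity.
    toClique : ∀ {m} → CliqueIn G (const true) m → HasClique m G
    toClique (f , _ , clique) = f , λ i j i≢j → distinct i j (clique i j i≢j) , clique i j i≢j
      where
      distinct : ∀ i j → adj G (f i) (f j) ≡ true → f i ≢ f j
      distinct i j fi~fj fi≡fj = contradiction
        (trans (sym (Graph.irrefl G (f i))) (trans (cong (adj G (f i)) fi≡fj) fi~fj)) λ ()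

    -- Over the whole vertex set the bichromatic and monochromatic pairs make up all `n²` ordered
    -- pairs, so the monochromatic ones are added to both sides of Füredi's inequality.
    all-coloured : ∀ r → Free (suc r) G → ∃ λ (c : Fin n → ℕ) → (∀ v → c v < r) ×
      ∑² (a G) + ∑² (λ u v → a G u v * ι (c u ≡ᵇ c v)) + ∑² (λ u v → ι (c u ≡ᵇ c v)) ≤ n * n
    all-coloured r free with füredi G r (const true) (free ∘ toClique)
    ... | c , c<r , bound = c , (λ v → c<r v refl) , (begin
      ∑² (a G) + ∑² P + ∑² Q              ≡⟨ cong (_+ ∑² Q) (sym (∑²-+ (a G) P)) ⟩
      ∑² (λ u v → a G u v + P u v) + ∑² Q
        ≡⟨ cong (_+ ∑² Q) (∑²-cong λ u v → e₁ (a G u v) (ι (c u ≡ᵇ c v))) ⟩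
      weighted G (const true) c + ∑² Q    ≤⟨ +-monoˡ-≤ (∑² Q) bound ⟩
      bichromatic G (const true) c + ∑² Q
        ≡⟨ sym (∑²-+ (λ u v → 1 * 1 * ι (not (c u ≡ᵇ c v))) Q) ⟩
      ∑² (λ u v → 1 * 1 * ι (not (c u ≡ᵇ c v)) + Q u v)
        ≡⟨ ∑²-cong (λ u v → complementary (c u ≡ᵇ c v)) ⟩
      ∑[ u < n ] ∑[ v < n ] 1
        ≡⟨ trans (sum-cong-≗ {n} λ _ → trans (∑-const n 1) (*-identityʳ n)) (∑-const n n) ⟩
      n * n ∎)
      where
      open ≤-Reasoning
      P Q : Fin n → Fin n → ℕ
      P u v = a G u v * ι (c u ≡ᵇ c v)
      Q u v = ι (c u ≡ᵇ c v)
      e₁ : ∀ a q → a + a * q ≡ 1 * 1 * a * (1 + q)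
      e₁ = solve-∀
      complementary : ∀ q → 1 * 1 * ι (not q) + ι q ≡ 1
      complementary true  = refl
      complementary false = refl

    outside-degree : (Fin n → ℕ) → Fin n → ℕ
    outside-degree c u = ∑[ v < n ] (a G u v * ι (not (c u ≡ᵇ c v)))

    outside+mono : ∀ c → ∑² (a G) ≡ sum (outside-degree c) + ∑² (λ u v → a G u v * ι (c u ≡ᵇ c v))
    outside+mono c = trans (∑²-cong split)
      (∑²-+ (λ u v → a G u v * ι (not (c u ≡ᵇ c v))) (λ u v → a G u v * ι (c u ≡ᵇ c v)))
      where
      e₁ : ∀ a → a ≡ a * 0 + a * 1
      e₁ = solve-∀
      e₂ : ∀ a → a ≡ a * 1 + a * 0
      e₂ = solve-∀
      split : ∀ u v → a G u v ≡ a G u v * ι (not (c u ≡ᵇ c v)) + a G u v * ι (c u ≡ᵇ c v)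
      split u v with c u ≡ᵇ c v
      ... | true  = e₁ (a G u v)
      ... | false = e₂ (a G u v)

    -- `B` lies within one colour class, so an edge from `B` to another colour also leaves `B`.
    outside≤crossing : ∀ c j B → (∀ v → B v ≡ true → (c v ≡ᵇ j) ≡ true) →
      ∑[ u < n ] (ι (B u) * outside-degree c u) ≤ crossing B
    outside≤crossing c j B B⊆j = ∑-mono λ u → ≤-trans
      (≤-reflexive (*-distribˡ-sum (ι (B u)) (λ v → a G u v * ι (not (c u ≡ᵇ c v))))) (∑-mono (pointwise u))
      where
      pointwise : ∀ u v → ι (B u) * (a G u v * ι (not (c u ≡ᵇ c v))) ≤ ι (B u) * ι (not (B v)) * a G u v
      pointwise u v with B u in Bu | B v in Bv
      ... | false | _     = z≤n
      ... | true  | false = *-monoʳ-≤ 1 (a*ι≤a (a G u v) (not (c u ≡ᵇ c v)))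
        where
        a*ι≤a : ∀ a q → a * ι q ≤ a
        a*ι≤a a true  = ≤-reflexive (*-identityʳ a)
        a*ι≤a a false = ≤-trans (≤-reflexive (*-zeroʳ a)) z≤n
      ... | true  | true
        rewrite ≡ᵇ-true (c u) j (B⊆j u Bu) | ≡ᵇ-true (c v) j (B⊆j v Bv) | ≡ᵇ-refl j | *-zeroʳ (a G u v) = z≤n

    -- The class sizes sum to `n` and the class totals of outside degree to the global total, so
    -- some class does at least as well as the global average. Averages are cross-multiplied, so
    -- empty classes need no separate treatment.
    rich-class : ∀ {r′} c (c<r : ∀ v → c v < suc r′) → ∃ λ (i : Fin (suc r′)) →
      size c i * sum (outside-degree c) ≤ n * ∑[ v < n ] (ι (c v ≡ᵇ toℕ i) * outside-degree c v)
    rich-class {r′} c c<r = ∑-pigeonhole _ _ (≤-reflexive (begin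
      ∑[ i < suc r′ ] (size c i * O)  ≡⟨ sym (*-distribʳ-sum {suc r′} O (size c)) ⟩
      sum {suc r′} (size c) * O                ≡⟨ cong (_* O) (∑-size c c<r) ⟩
      n * O                               ≡⟨ cong (n *_) (sym (∑-by-colour c c<r (λ v _ → outside-degree c v))) ⟩
      n * ∑[ i < suc r′ ] o i             ≡⟨ *-distribˡ-sum n o ⟩
      ∑[ i < suc r′ ] (n * o i)           ∎))
      where
      open ≡-Reasoning
      O = sum (outside-degree c)
      o : Fin (suc r′) → ℕ
      o i = ∑[ v < n ] (ι (c v ≡ᵇ toℕ i) * outside-degree c v)

    -- Chains `O / n ≤ o / m ≤ oB / b ≤ C / b`, where `o` and `oB` total the outside degrees over a
    -- class of `m` vertices and over its top `b`. The case `b = 0` is split off because `m` has to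
    -- be cancelled.
    crossing-large : ∀ b m O o oB C → b ≤ m → m * O ≤ n * o → b * o ≤ m * oB → oB ≤ C → b * O ≤ n * C
    crossing-large zero    m O o oB C _ _ _ _ = z≤n
    crossing-large b@(suc _) m@(suc _) O o oB C _ h₁ h₂ h₃ = *-cancelˡ-≤ m (begin
      m * (b * O)        ≡⟨ e₁ m b O ⟩
      b * (m * O)        ≤⟨ *-monoʳ-≤ b h₁ ⟩
      b * (n * o)        ≡⟨ e₁ b n o ⟩
      n * (b * o)        ≤⟨ *-monoʳ-≤ n h₂ ⟩
      n * (m * oB)       ≤⟨ *-monoʳ-≤ n (*-monoʳ-≤ m h₃) ⟩
      n * (m * C)        ≡⟨ e₁ n m C ⟩
      m * (n * C)        ∎)
      where
      open ≤-Reasoning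
      e₁ : ∀ x y z → x * (y * z) ≡ y * (x * z)
      e₁ = solve-∀

  -- The cut with `b` vertices on the small side, over the naturals.

  unbalanced-cut⁺ : ∀ {n} (G : Graph n) r′ b → .{{_ : NonZero n}} → let r = suc r′ in
    4 * (r * r) * b ≤ n → Free (suc r) G → ∃ λ (B : Fin n → Bool) →
    card B ≡ b × r * inside G B + r′ * (n * (2 * b)) ≤ r′ * (n * n)
  unbalanced-cut⁺ {n} G r′ b b-small free
    with suc r′ * ∑² (a G) + r′ * (n * (2 * b)) ≤? r′ * (n * n)
  -- In a sparse graph any `b` vertices will do, hence the constant weight below.
  ... | yes sparse = B , ∣B∣ , ≤-trans (+-monoˡ-≤ _ (*-monoʳ-≤ (suc r′) inside≤)) sparse
    where
    b≤n : b ≤ card {n} (const true)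
    b≤n = ≤-trans (≤-trans (m≤n*m b (4 * (suc r′ * suc r′))) b-small)
      (≤-reflexive (sym (trans (∑-const n 1) (*-identityʳ n))))
    open Top (takeTop {n} (const true) (const 0) b b≤n)
    inside≤ : inside G B ≤ ∑² (a G)
    inside≤ = ≤-trans (m≤m+n _ _) (≤-reflexive (sym (edges-split G B)))
  ... | no dense with all-coloured G (suc r′) free
  ...   | c , c<r , F = B , ∣B∣ , cut-arithmetic r′ n b _ _ _ _ _ (mono-pairs c)
      4b≤n (edges-split G B) (outside+mono G c) bO≤nC F n²≤rQ
    where
    r = suc r′
    parts : ∀ j → b ≤ size c j
    parts = big-parts c c<r b b-small
      (few-mono-pairs r′ n b _ _ (mono-pairs c) F (<⇒≤ (≰⇒> dense)))
    i = proj₁ (rich-class G c c<r)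
    t = takeTop (colourClass c (toℕ i)) (outside-degree G c) b (parts i)
    open Top t
    4b≤n : 4 * b ≤ n
    4b≤n = ≤-trans (*-monoˡ-≤ b (m≤m*n 4 (r * r))) b-small
    bO≤nC : b * sum (outside-degree G c) ≤ n * crossing G B
    bO≤nC = crossing-large G b _ _ _ _ _ (parts i) (proj₂ (rich-class G c c<r)) (top-average t)
      (outside≤crossing G c (toℕ i) B B⊆p)
    -- Cauchy-Schwarz for the class sizes: the squared deviations are dropped from the variance
    -- identity and `r` is cancelled.
    n²≤rQ : n * n ≤ r * mono-pairs c
    n²≤rQ = *-cancelˡ-≤ r (≤-trans (m≤m+n _ _) (≤-reflexive
      (trans (∑-deviation² c c<r) (*-assoc r r (mono-pairs c)))))

  -- With `b = n - k` and `k = α n` one has `n (n - 2b) = (2α - 1) n²`, and `inside` counts edges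
  -- twice, so this is the desired bound with the denominator `2r` cleared and the negative term
  -- moved to the left.
  unbalanced-cut : ∀ {n} (G : Graph n) r′ b → let r = suc r′ in
    4 * (r * r) * b ≤ n → Free (suc r) G → ∃ λ (B : Fin n → Bool) →
    card B ≡ b × r * inside G B + r′ * (n * (2 * b)) ≤ r′ * (n * n)
  -- The factor `n` cannot be cancelled here, but `b` is zero and both sides vanish.
  unbalanced-cut {zero} G r′ b b-small _ = (λ ()) , sym b≡0 , bound
    where
    b≡0 : b ≡ 0
    b≡0 = n≤0⇒n≡0 (≤-trans (m≤n*m b (4 * (suc r′ * suc r′))) b-small)
    bound : suc r′ * 0 + r′ * 0 ≤ r′ * 0
    bound rewrite *-zeroʳ r′ = ≤-refl
  unbalanced-cut {suc _} G r′ b = unbalanced-cut⁺ G r′ b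

  -- Translation to the subsets and the edge count of the statement.

  sum-allFin : ∀ {n} (f : Fin n → ℕ) → sumᴸ (List.map f (List.allFin n)) ≡ sum f
  sum-allFin {n} f = trans (cong sumᴸ (List.map-tabulate id f)) (sum-tabulate f)
    where
    sum-tabulate : ∀ {n} (f : Fin n → ℕ) → sumᴸ (List.tabulate f) ≡ sum f
    sum-tabulate {zero}  f = refl
    sum-tabulate {suc n} f = cong (f zero +_) (sum-tabulate (f ∘ suc))

  ∣∣≡card : ∀ {n} (A : Subset n) → ∣ A ∣ ≡ card (lookup A)
  ∣∣≡card []          = refl
  ∣∣≡card (true ∷ A)  = cong suc (∣∣≡card A)
  ∣∣≡card (false ∷ A) = ∣∣≡card A

  -- Two distinct vertices are increasing in exactly one of their two orders, and the diagonal
  -- contributes nothing by irreflexivity.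
  twice-e : ∀ {n} (G : Graph n) A → ∑² (λ u v → ι (lookup A u) * ι (lookup A v) * a G u v) ≡ 2 * e G A
  twice-e {n} G A = begin
    ∑² (λ u v → ι (lookup A u) * ι (lookup A v) * a G u v)  ≡⟨ ∑²-cong pointwise ⟩
    ∑² (λ u v → g u v + g v u)                              ≡⟨ ∑²-double g ⟩
    2 * ∑² g                                                ≡⟨ cong (2 *_) (sym e≡∑²) ⟩
    2 * e G A                                               ∎
    where
    open ≡-Reasoning
    g : Fin n → Fin n → ℕ
    g u v = ι ((toℕ u <ᵇ toℕ v) ∧ lookup A u ∧ lookup A v ∧ adj G u v)
    e≡∑² : e G A ≡ ∑² g
    e≡∑² = trans (sum-allFin (λ u → sumᴸ (List.map (g u) (List.allFin n)))) (sum-cong-≗ λ u → sum-allFin (g u))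
    ι-∧ : ∀ s t x → ι s * ι t * ι x ≡ ι (s ∧ t ∧ x)
    ι-∧ false _     _ = refl
    ι-∧ true  false _ = refl
    ι-∧ true  true  x = *-identityˡ (ι x)
    <ᵇ-true : ∀ m n → (m <ᵇ n) ≡ true → m < n
    <ᵇ-true m n eq = <ᵇ⇒< m n (subst T (sym eq) _)
    <ᵇ-false : ∀ {m n} → (m <ᵇ n) ≡ false → ¬ (m < n)
    <ᵇ-false eq m<n = subst T eq (<⇒<ᵇ m<n)
    pointwise : ∀ u v → ι (lookup A u) * ι (lookup A v) * a G u v ≡ g u v + g v u
    pointwise u v with toℕ u <ᵇ toℕ v in u<v | toℕ v <ᵇ toℕ u in v<u
    ... | true  | true  = contradiction (<ᵇ-true (toℕ v) (toℕ u) v<u) (<⇒≯ (<ᵇ-true (toℕ u) (toℕ v) u<v))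
    ... | true  | false = trans (ι-∧ (lookup A u) (lookup A v) (adj G u v)) (sym (+-identityʳ _))
    ... | false | true  rewrite Graph.sym G u v | *-comm (ι (lookup A u)) (ι (lookup A v)) =
      ι-∧ (lookup A v) (lookup A u) (adj G v u)
    ... | false | false rewrite toℕ-injective {i = u} {j = v} (≤-antisym (≮⇒≥ (<ᵇ-false {toℕ v} v<u)) (≮⇒≥ (<ᵇ-false {toℕ u} u<v))) | Graph.irrefl G v =
      *-zeroʳ (ι (lookup A v) * ι (lookup A v))

  -- `A` is the complement of `B` because the prescribed size `k` belongs to the large side; ordered
  -- pairs account for the factor 2.
  complement-cut : ∀ {n} (G : Graph n) B → let A = tabulate (not ∘ B) in
    inside G B ≡ 2 * (e G A + e G (∁ A))
  complement-cut {n} G B = begin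
    inside G B                                ≡⟨ ∑²-cong pointwise ⟩
    ∑² (λ u v → f A u v + f (∁ A) u v)        ≡⟨ ∑²-+ (f A) (f (∁ A)) ⟩
    ∑² (f A) + ∑² (f (∁ A))                   ≡⟨ cong₂ _+_ (twice-e G A) (twice-e G (∁ A)) ⟩
    2 * e G A + 2 * e G (∁ A)                 ≡⟨ sym (*-distribˡ-+ 2 (e G A) (e G (∁ A))) ⟩
    2 * (e G A + e G (∁ A))                   ∎
    where
    open ≡-Reasoning
    A = tabulate (not ∘ B)
    f : Subset n → Fin n → Fin n → ℕ
    f A u v = ι (lookup A u) * ι (lookup A v) * a G u v
    not-not : ∀ x → not (not x) ≡ x
    not-not true  = refl
    not-not false = refl
    ∈A : ∀ u → lookup A u ≡ not (B u)
    ∈A = lookup∘tabulate (not ∘ B)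
    ∈∁A : ∀ u → lookup (∁ A) u ≡ B u
    ∈∁A u = trans (lookup-map u not A) (trans (cong not (∈A u)) (not-not (B u)))
    pointwise : ∀ u v →
      (ι (B u) * ι (B v) + ι (not (B u)) * ι (not (B v))) * a G u v ≡ f A u v + f (∁ A) u v
    pointwise u v rewrite ∈A u | ∈A v | ∈∁A u | ∈∁A v =
      reorder (ι (B u) * ι (B v)) (ι (not (B u)) * ι (not (B v))) (a G u v)
      where
      reorder : ∀ x y z → (x + y) * z ≡ y * z + x * z
      reorder = solve-∀

  complement-card : ∀ {n} (B : Fin n → Bool) → ∣ tabulate (not ∘ B) ∣ + card B ≡ n
  complement-card {n} B = begin
    ∣ tabulate (not ∘ B) ∣ + card B            ≡⟨ cong (_+ card B) (∣∣≡card (tabulate (not ∘ B))) ⟩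
    card (lookup (tabulate (not ∘ B))) + card B
      ≡⟨ cong (_+ card B) (sum-cong-≗ {n} λ v → cong ι (lookup∘tabulate (not ∘ B) v)) ⟩
    card (not ∘ B) + card B                    ≡⟨ sym (∑-distrib-+ (ι ∘ not ∘ B) (ι ∘ B)) ⟩
    ∑[ v < n ] (ι (not (B v)) + ι (B v))       ≡⟨ sum-cong-≗ {n} (λ v → ι-not (B v)) ⟩
    ∑[ v < n ] 1                               ≡⟨ trans (∑-const n 1) (*-identityʳ n) ⟩
    n                                          ∎
    where
    open ≡-Reasoning
    ι-not : ∀ b → ι (not b) + ι b ≡ 1
    ι-not true  = refl
    ι-not false = refl

-- Rational arithmetic and the threshold for `α`.

open Combinatorics using (inside; card; unbalanced-cut; complement-cut; complement-card)
open import Data.Integer using (+_)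
import Data.Integer as ℤ
import Data.Integer.Properties as ℤ
open import Data.Rational using (ℚ; _<_; _*_; _-_; 1ℚ)
open import Data.Rational as ℚ using (_+_; -_; _/_; mkℚ; *≤*)
import Data.Rational.Properties as ℚ
open import Data.Rational.Solver using (module +-*-Solver)
import Data.Rational.Unnormalised as ℚᵘ
import Data.Rational.Unnormalised.Properties as ℚᵘ

-- The gcd inside `_/_` does not reduce for a variable `k`; rewriting to the explicit normal form
-- lets sums, products and comparisons compute.
⟦⟧-mkℚ : ∀ k → ⟦ k ⟧ ≡ mkℚ (+ k) 0 (coprime-sym (1-coprimeTo k))
⟦⟧-mkℚ k = ℚ.normalize-coprime (coprime-sym (1-coprimeTo k))

⟦⟧-+ : ∀ m n → ⟦ m ℕ.+ n ⟧ ≡ ⟦ m ⟧ + ⟦ n ⟧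
⟦⟧-+ m n rewrite ⟦⟧-mkℚ m | ⟦⟧-mkℚ n | ℤ.*-identityʳ (+ m) | ℤ.*-identityʳ (+ n) = refl

⟦⟧-* : ∀ m n → ⟦ m ℕ.* n ⟧ ≡ ⟦ m ⟧ * ⟦ n ⟧
⟦⟧-* m n rewrite ⟦⟧-mkℚ m | ⟦⟧-mkℚ n = cong (_/ 1) (ℤ.pos-* m n)

⟦⟧-mono : ∀ {m n} → m ℕ.≤ n → ⟦ m ⟧ ℚ.≤ ⟦ n ⟧
⟦⟧-mono {m} {n} m≤n rewrite ⟦⟧-mkℚ m | ⟦⟧-mkℚ n = *≤* (ℤ.*-monoʳ-≤-nonNeg (+ 1) (ℤ.+≤+ m≤n))

⟦⟧-cancel : ∀ {m n} → ⟦ m ⟧ ℚ.≤ ⟦ n ⟧ → m ℕ.≤ n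
⟦⟧-cancel {m} {n} le rewrite ⟦⟧-mkℚ m | ⟦⟧-mkℚ n =
  ℤ.drop‿+≤+ (ℤ.*-cancelʳ-≤-pos (+ m) (+ n) (+ 1) (ℚ.drop-*≤* le))

⟦⟧-nonNeg : ∀ n → ℚ.NonNegative ⟦ n ⟧
⟦⟧-nonNeg n = ℚ.nonNegative (⟦⟧-mono {0} {n} z≤n)

-- This is `1 - 1 / (N + 1)`, so any `α` from here on leaves at most `n / (N + 1)` vertices outside
-- `A`.
threshold : ℕ → ℚ
threshold N = + N / suc N

threshold<1 : ∀ N → threshold N < 1ℚ
threshold<1 N = ℚ.toℚᵘ-cancel-< (ℚᵘ.<-respˡ-≃ (ℚᵘ.≃-sym (ℚ.toℚᵘ-fromℚᵘ (ℚᵘ.mkℚᵘ (+ N) N)))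
  (ℚᵘ.*<* (subst₂ ℤ._<_ (sym (ℤ.*-identityʳ (+ N))) (sym (ℤ.*-identityˡ (+ suc N))) (ℤ.+<+ ℕ.≤-refl))))

threshold-* : ∀ N → ⟦ suc N ⟧ * threshold N ≡ ⟦ N ⟧
threshold-* N = ℚ.toℚᵘ-injective (begin
  ℚ.toℚᵘ (⟦ suc N ⟧ * threshold N)                ≈⟨ ℚ.toℚᵘ-homo-* ⟦ suc N ⟧ (threshold N) ⟩
  ℚ.toℚᵘ ⟦ suc N ⟧ ℚᵘ.* ℚ.toℚᵘ (threshold N)      ≈⟨ ℚᵘ.*-cong (ℚ.toℚᵘ-fromℚᵘ (ℚᵘ.mkℚᵘ (+ suc N) 0))
                                                       (ℚ.toℚᵘ-fromℚᵘ (ℚᵘ.mkℚᵘ (+ N) N)) ⟩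
  ℚᵘ.mkℚᵘ (+ suc N) 0 ℚᵘ.* ℚᵘ.mkℚᵘ (+ N) N        ≈⟨ ℚᵘ.*≡* cross ⟩
  ℚᵘ.mkℚᵘ (+ N) 0                                 ≈⟨ ℚᵘ.≃-sym (ℚ.toℚᵘ-fromℚᵘ (ℚᵘ.mkℚᵘ (+ N) 0)) ⟩
  ℚ.toℚᵘ ⟦ N ⟧                                    ∎)
  where
  open ℚᵘ.≃-Reasoning
  cross : (+ suc N ℤ.* + N) ℤ.* + 1 ≡ + N ℤ.* + suc (N ℕ.+ 0)
  cross rewrite ℕ.+-identityʳ N = trans (ℤ.*-identityʳ _) (ℤ.*-comm (+ suc N) (+ N))

k≤n : ∀ {α n k} → α ℚ.≤ 1ℚ → α * ⟦ n ⟧ ≡ ⟦ k ⟧ → k ℕ.≤ n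
k≤n {α} {n} {k} α≤1 αn≡k = ⟦⟧-cancel (begin
  ⟦ k ⟧          ≡⟨ sym αn≡k ⟩
  α * ⟦ n ⟧      ≤⟨ ℚ.*-monoʳ-≤-nonNeg ⟦ n ⟧ {{⟦⟧-nonNeg n}} α≤1 ⟩
  1ℚ * ⟦ n ⟧     ≡⟨ ℚ.*-identityˡ ⟦ n ⟧ ⟩
  ⟦ n ⟧          ∎)
  where open ℚ.≤-Reasoning

threshold-≤ : ∀ {α n k} N → threshold N ℚ.≤ α → α * ⟦ n ⟧ ≡ ⟦ k ⟧ → N ℕ.* n ℕ.≤ suc N ℕ.* k
threshold-≤ {α} {n} {k} N c≤α αn≡k = ⟦⟧-cancel (begin
  ⟦ N ℕ.* n ⟧                          ≡⟨ ⟦⟧-* N n ⟩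
  ⟦ N ⟧ * ⟦ n ⟧                        ≡⟨ cong (_* ⟦ n ⟧) (sym (threshold-* N)) ⟩
  ⟦ suc N ⟧ * threshold N * ⟦ n ⟧      ≤⟨ ℚ.*-monoʳ-≤-nonNeg ⟦ n ⟧ {{⟦⟧-nonNeg n}}
                                            (ℚ.*-monoˡ-≤-nonNeg ⟦ suc N ⟧ {{⟦⟧-nonNeg (suc N)}} c≤α) ⟩
  ⟦ suc N ⟧ * α * ⟦ n ⟧                ≡⟨ ℚ.*-assoc ⟦ suc N ⟧ α ⟦ n ⟧ ⟩
  ⟦ suc N ⟧ * (α * ⟦ n ⟧)              ≡⟨ cong (⟦ suc N ⟧ *_) αn≡k ⟩
  ⟦ suc N ⟧ * ⟦ k ⟧                    ≡⟨ sym (⟦⟧-* (suc N) k) ⟩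
  ⟦ suc N ℕ.* k ⟧                      ∎)
  where open ℚ.≤-Reasoning

small-complement : ∀ N n k b → k ℕ.+ b ≡ n → N ℕ.* n ℕ.≤ suc N ℕ.* k → suc N ℕ.* b ℕ.≤ n
small-complement N n k b refl le = ℕ.+-cancelˡ-≤ (N ℕ.* (k ℕ.+ b)) _ _ (begin
  N ℕ.* (k ℕ.+ b) ℕ.+ suc N ℕ.* b     ≤⟨ ℕ.+-monoˡ-≤ (suc N ℕ.* b) le ⟩
  suc N ℕ.* k ℕ.+ suc N ℕ.* b         ≡⟨ regroup N k b ⟩
  N ℕ.* (k ℕ.+ b) ℕ.+ (k ℕ.+ b)       ∎)
  where
  open ℕ.≤-Reasoning
  regroup : ∀ N k b → (1 ℕ.+ N) ℕ.* k ℕ.+ (1 ℕ.+ N) ℕ.* b ≡ N ℕ.* (k ℕ.+ b) ℕ.+ (k ℕ.+ b)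
  regroup = ℕ-Solver.solve-∀

-- From `k = α n` follows `2 k n - n² = (2α - 1) n²`. The hypothesis keeps the negative term on the
-- left, so subtraction happens only in ℚ.
rational-bound : ∀ {α n k} r′ X → α * ⟦ n ⟧ ≡ ⟦ k ⟧ →
  X ℕ.+ r′ ℕ.* (n ℕ.* n) ℕ.≤ r′ ℕ.* (2 ℕ.* k ℕ.* n) →
  ⟦ X ⟧ ℚ.≤ ⟦ r′ ⟧ * (⟦ 2 ⟧ * α - 1ℚ) * (⟦ n ⟧ * ⟦ n ⟧)
rational-bound {α} {n} {k} r′ X αn≡k le = begin
  ⟦ X ⟧                                            ≡⟨ add-sub ⟦ X ⟧ R ⟩
  (⟦ X ⟧ + R) - R                                  ≡⟨ cong (λ z → (⟦ X ⟧ + z) - R) (sym R≡) ⟩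
  (⟦ X ⟧ + ⟦ r′ ℕ.* (n ℕ.* n) ⟧) - R               ≡⟨ cong (_- R) (sym (⟦⟧-+ X _)) ⟩
  ⟦ X ℕ.+ r′ ℕ.* (n ℕ.* n) ⟧ - R                   ≤⟨ ℚ.+-monoˡ-≤ (- R) (⟦⟧-mono le) ⟩
  ⟦ r′ ℕ.* (2 ℕ.* k ℕ.* n) ⟧ - R                   ≡⟨ cong (_- R) S≡ ⟩
  ⟦ r′ ⟧ * (⟦ 2 ⟧ * (α * ⟦ n ⟧) * ⟦ n ⟧) - R       ≡⟨ factor ⟦ r′ ⟧ ⟦ 2 ⟧ α ⟦ n ⟧ ⟩
  ⟦ r′ ⟧ * (⟦ 2 ⟧ * α - 1ℚ) * (⟦ n ⟧ * ⟦ n ⟧)      ∎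
  where
  open ℚ.≤-Reasoning
  R = ⟦ r′ ⟧ * (⟦ n ⟧ * ⟦ n ⟧)
  R≡ : ⟦ r′ ℕ.* (n ℕ.* n) ⟧ ≡ R
  R≡ = trans (⟦⟧-* r′ (n ℕ.* n)) (cong (⟦ r′ ⟧ *_) (⟦⟧-* n n))
  S≡ : ⟦ r′ ℕ.* (2 ℕ.* k ℕ.* n) ⟧ ≡ ⟦ r′ ⟧ * (⟦ 2 ⟧ * (α * ⟦ n ⟧) * ⟦ n ⟧)
  S≡ rewrite αn≡k = trans (⟦⟧-* r′ (2 ℕ.* k ℕ.* n)) (cong (⟦ r′ ⟧ *_)
    (trans (⟦⟧-* (2 ℕ.* k) n) (cong (_* ⟦ n ⟧) (⟦⟧-* 2 k))))
  open +-*-Solver using (solve; _:=_; _:+_; _:-_; _:*_; con)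
  add-sub : ∀ x y → x ≡ (x + y) - y
  add-sub = solve 2 (λ x y → x := (x :+ y) :- y) refl
  factor : ∀ r t α n → r * (t * (α * n) * n) - r * (n * n) ≡ r * (t * α - 1ℚ) * (n * n)
  factor = solve 4 (λ r t α n →
    r :* (t :* (α :* n) :* n) :- r :* (n :* n) := r :* (t :* α :- con 1ℚ) :* (n :* n)) refl

-- For `n = k + b` one has `2 n² = 2 k n + 2 b n`, so adding `r′ n²` to the bound on the cut trades
-- `b` for `k`.
unbalanced-cut-numerator : ∀ r′ n k b E → k ℕ.+ b ≡ n → let r = suc r′ in
  r ℕ.* (2 ℕ.* E) ℕ.+ r′ ℕ.* (n ℕ.* (2 ℕ.* b)) ≤ r′ ℕ.* (n ℕ.* n) →
  2 ℕ.* r ℕ.* E ℕ.+ r′ ℕ.* (n ℕ.* n) ≤ r′ ℕ.* (2 ℕ.* k ℕ.* n)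
unbalanced-cut-numerator r′ n k b E refl le = ℕ.+-cancelʳ-≤ (r′ ℕ.* (n ℕ.* (2 ℕ.* b))) _ _ (begin
  2 ℕ.* suc r′ ℕ.* E ℕ.+ r′ ℕ.* (n ℕ.* n) ℕ.+ r′ ℕ.* (n ℕ.* (2 ℕ.* b))
    ≡⟨ regroup (suc r′) E (r′ ℕ.* (n ℕ.* n)) (r′ ℕ.* (n ℕ.* (2 ℕ.* b))) ⟩
  suc r′ ℕ.* (2 ℕ.* E) ℕ.+ r′ ℕ.* (n ℕ.* (2 ℕ.* b)) ℕ.+ r′ ℕ.* (n ℕ.* n)
    ≤⟨ ℕ.+-monoˡ-≤ (r′ ℕ.* (n ℕ.* n)) le ⟩
  r′ ℕ.* (n ℕ.* n) ℕ.+ r′ ℕ.* (n ℕ.* n)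
    ≡⟨ double r′ k b ⟩
  r′ ℕ.* (2 ℕ.* k ℕ.* n) ℕ.+ r′ ℕ.* (n ℕ.* (2 ℕ.* b)) ∎)
  where
  open ℕ.≤-Reasoning
  regroup : ∀ r E x y → 2 ℕ.* r ℕ.* E ℕ.+ x ℕ.+ y ≡ r ℕ.* (2 ℕ.* E) ℕ.+ y ℕ.+ x
  regroup = ℕ-Solver.solve-∀
  double : ∀ r k b → r ℕ.* ((k ℕ.+ b) ℕ.* (k ℕ.+ b)) ℕ.+ r ℕ.* ((k ℕ.+ b) ℕ.* (k ℕ.+ b)) ≡
    r ℕ.* (2 ℕ.* k ℕ.* (k ℕ.+ b)) ℕ.+ r ℕ.* ((k ℕ.+ b) ℕ.* (2 ℕ.* b))
  double = ℕ-Solver.solve-∀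

theorem1p11 : (r : ℕ) → 1 ≤ r →
    Σ ℚ λ c → c < 1ℚ ×
    ((α : ℚ) → c ℚ.≤ α → α ℚ.≤ 1ℚ →
    (n : ℕ) → (k : ℕ) → α * ⟦ n ⟧ ≡ ⟦ k ⟧ →
    (G : Graph n) → Free (ℕ.suc r) G →
    Σ (Subset n) λ A → ∣ A ∣ ≡ k ×
    ⟦ 2 ℕ.* r ⟧ * ⟦ e G A ℕ.+ e G (∁ A) ⟧
    ℚ.≤ ⟦ r ∸ 1 ⟧ * (⟦ 2 ⟧ * α - 1ℚ) * (⟦ n ⟧ * ⟦ n ⟧))
theorem1p11 r@(suc r′) _ = threshold N , threshold<1 N , cut
  where
  -- `suc N` is `4 r²`, so that `small-complement` yields `4 r² b ≤ n`, the smallness of `b` that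
  -- `unbalanced-cut` asks for.
  N : ℕ
  N = ℕ.pred (4 ℕ.* (r ℕ.* r))
  cut : (α : ℚ) → threshold N ℚ.≤ α → α ℚ.≤ 1ℚ → (n k : ℕ) → α * ⟦ n ⟧ ≡ ⟦ k ⟧ →
    (G : Graph n) → Free (suc r) G → Σ (Subset n) λ A → ∣ A ∣ ≡ k ×
    ⟦ 2 ℕ.* r ⟧ * ⟦ e G A ℕ.+ e G (∁ A) ⟧ ℚ.≤ ⟦ r′ ⟧ * (⟦ 2 ⟧ * α - 1ℚ) * (⟦ n ⟧ * ⟦ n ⟧)
  cut α c≤α α≤1 n k αn≡k G free = A , ∣A∣≡k , (begin
    ⟦ 2 ℕ.* r ⟧ * ⟦ E ⟧       ≡⟨ sym (⟦⟧-* (2 ℕ.* r) E) ⟩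
    ⟦ 2 ℕ.* r ℕ.* E ⟧         ≤⟨ rational-bound {α} {n} {k} r′ (2 ℕ.* r ℕ.* E) αn≡k
                                   (unbalanced-cut-numerator r′ n k b E k+b≡n numerator) ⟩
    ⟦ r′ ⟧ * (⟦ 2 ⟧ * α - 1ℚ) * (⟦ n ⟧ * ⟦ n ⟧) ∎)
    where
    open ℚ.≤-Reasoning
    b = n ∸ k
    k+b≡n : k ℕ.+ b ≡ n
    k+b≡n = ℕ.m+[n∸m]≡n (k≤n {α} {n} {k} α≤1 αn≡k)
    found = unbalanced-cut G r′ b (small-complement N n k b k+b≡n (threshold-≤ {α} {n} {k} N c≤α αn≡k)) free
    B = proj₁ found
    A : Subset n
    A = tabulate (not ∘ B)
    E : ℕ
    E = e G A ℕ.+ e G (∁ A)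
    ∣A∣≡k : ∣ A ∣ ≡ k
    ∣A∣≡k = ℕ.+-cancelʳ-≡ b _ _ (trans (trans (cong (∣ A ∣ ℕ.+_) (sym (proj₁ (proj₂ found))))
      (complement-card B)) (sym k+b≡n))
    numerator : r ℕ.* (2 ℕ.* E) ℕ.+ r′ ℕ.* (n ℕ.* (2 ℕ.* b)) ≤ r′ ℕ.* (n ℕ.* n)
    numerator = subst (λ z → r ℕ.* z ℕ.+ r′ ℕ.* (n ℕ.* (2 ℕ.* b)) ≤ r′ ℕ.* (n ℕ.* n))
      (complement-cut G B) (proj₂ (proj₂ found))
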